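{- Let $k\geq 2$. Let $\mathcal{R}$ be a set of $n$ axis-parallel rectangles in the plane, and let $H=H(\mathcal{R})$. Then $f_H(k-1)=O(k\log^2 n)$.
   Context: For a finite family $\mathcal{R}$ of regions in $\mathbb{R}^2$ and a point $p$, let $r(p)=\{R\in\mathcal{R}: p\in R\}$. The hypergraph induced by $\mathcal{R}$ is $H(\mathcal{R})=(\mathcal{R},\{r(p)\}_{p\in\mathbb{R}^2})$. $k$-Strong-Conflict-Free ($k$SCF) coloring of a hypergraph: a coloring of the vertices such that (i) every hyperedge $e$ with $|e|\geq k$ contains at least $k$ vertices each of whose color is unique among the colors of vertices of $e$, and (ii) every hyperedge $e$ with $|e|<k$ has all its vertices colored distinctly. $f_H(k)$ is the least number of colors in a $k$SCF-coloring of $H$. The implied constant is absolute.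
   Formalization: The rectangles are closed with rational corners and the points p range over the rational plane instead of the real plane. -}

module Defs where

open import Data.Nat using (ℕ; _≤_; _<_)
open import Data.Fin using (Fin)
open import Data.List using (List; length; filter; allFin)
open import Data.List.Membership.Propositional using (_∈_)
open import Data.List.Relation.Unary.All using (All)
open import Data.List.Relation.Unary.Unique.Propositional using (Unique)
open import Data.Product using (_×_; _,_; ∃)
open import Data.Rational using (ℚ) renaming (_≤_ to _≤ℚ_)
open import Data.Rational.Properties using () renaming (_≤?_ to _≤ℚ?_)
open import Relation.Nullary using (Dec)
open import Relation.Nullary.Decidable using (_×-dec_)
open import Relation.Binary.PropositionalEquality using (_≡_)

-- A closed axis-parallel rectangle [x₁,x₂] × [y₁,y₂] with rational corners.
record Rect : Set where
  constructor rect
  field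
    x₁ x₂ y₁ y₂ : ℚ

Point : Set
Point = ℚ × ℚ

_∈R_ : Point → Rect → Set
(px , py) ∈R rect x₁ x₂ y₁ y₂ = (x₁ ≤ℚ px × px ≤ℚ x₂) × (y₁ ≤ℚ py × py ≤ℚ y₂)

_∈R?_ : (p : Point) → (R : Rect) → Dec (p ∈R R)
(px , py) ∈R? rect x₁ x₂ y₁ y₂ =
  ((x₁ ≤ℚ? px) ×-dec (px ≤ℚ? x₂)) ×-dec ((y₁ ≤ℚ? py) ×-dec (py ≤ℚ? y₂))

-- The hyperedge r(p) of H(ℛ) for the family ℛ = (R i)_{i : Fin n},
-- as the (duplicate-free) list of indices of rectangles containing p.
edge : ∀ {n} → (Fin n → Rect) → Point → List (Fin n)
edge {n} R p = filter (λ i → p ∈R? R i) (allFin n)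

UniqueColoured : ∀ {n m} → (Fin n → Fin m) → List (Fin n) → Fin n → Set
UniqueColoured c e i = i ∈ e × (∀ j → j ∈ e → c j ≡ c i → j ≡ i)

SCFEdge : ∀ {n m} → ℕ → (Fin n → Fin m) → List (Fin n) → Set
SCFEdge {n} k c e =
  (k ≤ length e → ∃ λ (u : List (Fin n)) → length u ≡ k × Unique u × All (UniqueColoured c e) u)
  × (length e < k → ∀ i j → i ∈ e → j ∈ e → c i ≡ c j → i ≡ j)

IsKSCFColouring : ∀ {n m} → ℕ → (Fin n → Rect) → (Fin n → Fin m) → Set
IsKSCFColouring k R c = ∀ (p : Point) → SCFEdge k c (edge R p)

{-# OPTIONS --safe #-}
module Submission where

-- Colour in rounds: each round removes a set V from the remaining rectangles S and gives it one new
-- colour, where every point p either lies in at most one member of V or still lies in k − 1 members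
-- of S ∖ V. If |S| = O(k log n) |V| in every round, then O(k log² n) rounds suffice.
--
-- To find V, sort the x-extents into O(log n) dyadic levels and keep the most frequent one. Within
-- it, the rectangles of a group cross a common vertical line, so on each side of that line a point
-- is contained in a rectangle iff three inequalities hold. Call i and j close if at most k
-- rectangles dominate the lower of i and j in each of these three orders. One of i, j is the lower
-- one in two of the orders, and the other one is then among the k first candidates in the third, so
-- closeness can be oriented with outdegree O(k) and has an independent set V of size Ω(|S| / (k log n)).
-- If p lies in two members of V, take the two highest ones in the order pointing away from the
-- line: more than k rectangles dominate the lower of the two in each order; all of them contain p,
-- and no third one belongs to V.

open import Defs
open import Algebra.Properties.CommutativeSemigroup using (x∙yz≈y∙xz)
open import Data.Fin as Fin using (Fin)
import Data.Fin.Properties as Fin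
open import Data.List using (List; []; _∷_; _++_; length; filter; map; take; allFin)
import Data.List.Membership.DecPropositional as DecMembership
open import Data.List.Membership.Propositional using (_∈_; _∉_; find; lose)
open import Data.List.Membership.Propositional.Properties using (∈-filter⁺; ∈-filter⁻; ∈-∃++; ∈-++⁺ˡ; ∈-++⁺ʳ; ∈-++⁻; ∈-allFin)
open import Data.List.Properties using (length-++; length-take; length-tabulate; length-filter; filter-notAll)
open import Data.List.Relation.Unary.All as All using (All; []; _∷_)
import Data.List.Relation.Unary.All.Properties as All
open import Data.List.Relation.Unary.AllPairs as AllPairs using ([]; _∷_)
open import Data.List.Relation.Unary.Any using (here; there; any?)
open import Data.List.Relation.Unary.Unique.Propositional using (Unique)
open import Data.List.Relation.Unary.Unique.Propositional.Properties using (allFin⁺; filter⁺; take⁺; Unique[x∷xs]⇒x∉xs)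
open import Data.Nat using (ℕ; NonZero; zero; suc; _+_; _*_; _^_; _∸_; ⌊_/2⌋; ⌈_/2⌉; _≤_; _<_; z≤n; s≤s; s≤s⁻¹; _≤?_)
open import Data.Nat.Induction using (<-rec)
open import Data.Nat.ListAction using (sum)
open import Data.Nat.Logarithm using (⌊log₂_⌋; ⌊log₂⌋-mono-≤; ⌊log₂⌊n/2⌋⌋≡⌊log₂n⌋∸1)
open import Data.Nat.Properties
open import Data.Nat.Solver using (module +-*-Solver)
open import Data.Product using (_×_; _,_; ∃; proj₁; proj₂)
open import Data.Product.Relation.Binary.Lex.NonStrict using (×-decTotalOrder)
open import Data.Rational as ℚ using (ℚ)
import Data.Rational.Properties as ℚ
open import Data.Sum using (_⊎_; inj₁; inj₂; [_,_]′)
open import Function using (_∘_; flip)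
open import Function.Definitions using (Injective)
open import Level using (0ℓ)
open import Relation.Binary.Bundles using (DecTotalOrder)
open import Relation.Binary.Core using (Rel)
open import Relation.Binary.Definitions using (Decidable; DecidableEquality; Total; Transitive)
open import Relation.Binary.PropositionalEquality using (_≡_; _≢_; refl; sym; trans; cong; subst)
open import Relation.Nullary using (¬_; Dec; yes; no; contradiction)
open import Relation.Nullary.Decidable using (¬?; _×-dec_; _⊎-dec_)
open import Relation.Unary using (Pred) renaming (Decidable to Decidable₁)

private
  variable
    A : Set

count : {P : Pred A 0ℓ} → Decidable₁ P → List A → ℕ
count P? xs = length (filter P? xs)

length-⊆ : {xs ys : List A} → Unique xs → (∀ {x} → x ∈ xs → x ∈ ys) → length xs ≤ length ys
length-⊆ {xs = []} _ _ = z≤n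
length-⊆ {xs = x ∷ xs} u@(_ ∷ uxs) sub with ∈-∃++ (sub (here refl))
... | as , bs , refl = begin
    suc (length xs)              ≤⟨ s≤s (length-⊆ uxs sub′) ⟩
    suc (length (as ++ bs))      ≡⟨ cong suc (length-++ as) ⟩
    suc (length as + length bs)  ≡⟨ sym (+-suc (length as) (length bs)) ⟩
    length as + suc (length bs)  ≡⟨ sym (length-++ as) ⟩
    length (as ++ x ∷ bs)        ∎
  where
    open ≤-Reasoning
    sub′ : ∀ {z} → z ∈ xs → z ∈ as ++ bs
    sub′ z∈ with ∈-++⁻ as (sub (there z∈))
    ... | inj₁ z∈as = ∈-++⁺ˡ z∈as
    ... | inj₂ (here refl) = contradiction z∈ (Unique[x∷xs]⇒x∉xs u)
    ... | inj₂ (there z∈bs) = ∈-++⁺ʳ as z∈bs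

module _ {P Q : Pred A 0ℓ} (P? : Decidable₁ P) (Q? : Decidable₁ Q) where

  count-mono : ∀ {xs ys} → Unique xs → (∀ {x} → x ∈ xs → x ∈ ys) →
               (∀ {x} → x ∈ xs → P x → Q x) → count P? xs ≤ count Q? ys
  count-mono u sub imp = length-⊆ (filter⁺ P? u) λ x∈ →
    let x∈xs , Px = ∈-filter⁻ P? x∈ in ∈-filter⁺ Q? (sub x∈xs) (imp x∈xs Px)

  count-⊎ : ∀ {xs} → Unique xs → count (λ x → P? x ⊎-dec Q? x) xs ≤ count P? xs + count Q? xs
  count-⊎ {xs} u = begin
      count (λ x → P? x ⊎-dec Q? x) xs       ≤⟨ length-⊆ (filter⁺ (λ x → P? x ⊎-dec Q? x) u) sub ⟩
      length (filter P? xs ++ filter Q? xs)  ≡⟨ length-++ (filter P? xs) ⟩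
      count P? xs + count Q? xs              ∎
    where
      open ≤-Reasoning
      sub : ∀ {x} → x ∈ filter (λ x → P? x ⊎-dec Q? x) xs → x ∈ filter P? xs ++ filter Q? xs
      sub x∈ with ∈-filter⁻ (λ x → P? x ⊎-dec Q? x) {xs = xs} x∈
      ... | x∈xs , inj₁ Px = ∈-++⁺ˡ (∈-filter⁺ P? x∈xs Px)
      ... | x∈xs , inj₂ Qx = ∈-++⁺ʳ (filter P? xs) (∈-filter⁺ Q? x∈xs Qx)

count+count-¬ : {P : Pred A 0ℓ} (P? : Decidable₁ P) (xs : List A) →
                count P? xs + count (¬? ∘ P?) xs ≡ length xs
count+count-¬ P? [] = refl
count+count-¬ P? (x ∷ xs) with P? x
... | yes _ = cong suc (count+count-¬ P? xs)
... | no  _ = trans (+-suc _ _) (cong suc (count+count-¬ P? xs))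

module _ {_≼_ : Rel A 0ℓ} (total : Total _≼_) (≼-trans : Transitive _≼_) where

  maximum : ∀ x xs → ∃ λ m → m ∈ x ∷ xs × (∀ {z} → z ∈ x ∷ xs → z ≼ m)
  maximum x [] = x , here refl , λ { (here refl) → [ (λ r → r) , (λ r → r) ]′ (total x x) }
  maximum x (y ∷ ys) with maximum y ys
  ... | m , m∈ , ub with total x m
  ...   | inj₁ x≼m = m , there m∈ , λ { (here refl) → x≼m ; (there z∈) → ub z∈ }
  ...   | inj₂ m≼x = x , here refl , λ { (here refl) → [ (λ r → r) , (λ r → r) ]′ (total x x)
                                       ; (there z∈) → ≼-trans (ub z∈) m≼x }

module _ {_≼_ : Rel A 0ℓ} (_≼?_ : Decidable _≼_) (total : Total _≼_) (≼-trans : Transitive _≼_)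
         {B : Pred A 0ℓ} (B? : Decidable₁ B) where

  TopRanked : ℕ → List A → Pred A 0ℓ
  TopRanked k xs z = B z × count (λ v → B? v ×-dec (z ≼? v)) xs ≤ k

  topRanked? : ∀ k xs → Decidable₁ (TopRanked k xs)
  topRanked? k xs z = B? z ×-dec (count (λ v → B? v ×-dec (z ≼? v)) xs ≤? k)

  count-topRanked : ∀ k {xs} → Unique xs → count (topRanked? k xs) xs ≤ k
  count-topRanked k {xs} u with filter (topRanked? k xs) xs in eq
  ... | [] = z≤n
  ... | y ∷ ys with maximum {_≼_ = flip _≼_} (λ a b → total b a) (λ p q → ≼-trans q p) y ys
  ...   | m , m∈ , lb = ≤-trans (length-⊆ (subst Unique eq (filter⁺ (topRanked? k xs) u)) sub)
                                (proj₂ (proj₂ (back m∈)))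
    where
      back : ∀ {z} → z ∈ y ∷ ys → z ∈ xs × TopRanked k xs z
      back z∈ = ∈-filter⁻ (topRanked? k xs) (subst (_ ∈_) (sym eq) z∈)
      sub : ∀ {z} → z ∈ y ∷ ys → z ∈ filter (λ v → B? v ×-dec (m ≼? v)) xs
      sub z∈ = ∈-filter⁺ (λ v → B? v ×-dec (m ≼? v)) (proj₁ (back z∈)) (proj₁ (proj₂ (back z∈)) , lb z∈)

count-<-suc : (f : A → ℕ) (m : ℕ) {xs : List A} → Unique xs →
              count (λ x → f x <? suc m) xs ≤ count (λ x → f x ≟ m) xs + count (λ x → f x <? m) xs
count-<-suc f m u = ≤-trans
  (count-mono (λ x → f x <? suc m) (λ x → (f x ≟ m) ⊎-dec (f x <? m)) u (λ x∈ → x∈)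
    λ _ fx<1+m → [ inj₂ , inj₁ ]′ (m≤n⇒m<n∨m≡n (s≤s⁻¹ fx<1+m)))
  (count-⊎ (λ x → f x ≟ m) (λ x → f x <? m) u)

pigeonhole : (f : A → ℕ) (m : ℕ) {xs : List A} → Unique xs →
             ∃ λ ℓ → count (λ x → f x <? m) xs ≤ m * count (λ x → f x ≟ ℓ) xs
pigeonhole f zero {xs} u = 0 , length-⊆ {ys = []} (filter⁺ (λ x → f x <? 0) u)
  λ x∈ → contradiction (proj₂ (∈-filter⁻ (λ x → f x <? 0) {xs = xs} x∈)) λ ()
pigeonhole f (suc m) {xs} u with pigeonhole f m u
... | ℓ , le with ≤-total (count (λ x → f x ≟ m) xs) (count (λ x → f x ≟ ℓ) xs)
...   | inj₁ #m≤#ℓ = ℓ , ≤-trans (count-<-suc f m u) (+-mono-≤ #m≤#ℓ le)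
...   | inj₂ #ℓ≤#m = m , ≤-trans (count-<-suc f m u) (+-monoʳ-≤ _ (≤-trans le (*-monoʳ-≤ m #ℓ≤#m)))

sum-map-≤ : (f : A → ℕ) (D : ℕ) {xs : List A} → All (λ x → f x ≤ D) xs → sum (map f xs) ≤ length xs * D
sum-map-≤ f D [] = z≤n
sum-map-≤ f D (p ∷ ps) = +-mono-≤ p (sum-map-≤ f D ps)

sum-map-≥ : (f : A → ℕ) (D : ℕ) {xs : List A} → All (λ x → D ≤ f x) xs → length xs * D ≤ sum (map f xs)
sum-map-≥ f D [] = z≤n
sum-map-≥ f D (p ∷ ps) = +-mono-≤ p (sum-map-≥ f D ps)

module _ {_⟶_ : Rel A 0ℓ} (_⟶?_ : Decidable _⟶_) where

  outdegree indegree : List A → A → ℕ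
  outdegree xs v = count (v ⟶?_) xs
  indegree  xs v = count (_⟶? v) xs

  sum-indegree-∷ : ∀ x xs ys → sum (map (indegree (x ∷ xs)) ys) ≡ outdegree ys x + sum (map (indegree xs) ys)
  sum-indegree-∷ x xs [] = refl
  sum-indegree-∷ x xs (y ∷ ys) with x ⟶? y
  ... | yes _ = cong suc (trans (cong (indegree xs y +_) (sum-indegree-∷ x xs ys)) (x∙yz≈y∙xz +-commutativeSemigroup (indegree xs y) (outdegree ys x) _))
  ... | no  _ = trans (cong (indegree xs y +_) (sum-indegree-∷ x xs ys)) (x∙yz≈y∙xz +-commutativeSemigroup (indegree xs y) (outdegree ys x) _)

  sum-indegree : ∀ xs ys → sum (map (indegree xs) ys) ≡ sum (map (outdegree ys) xs)
  sum-indegree [] ys = zeros ys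
    where
      zeros : ∀ ys → sum (map (indegree []) ys) ≡ 0
      zeros [] = refl
      zeros (_ ∷ ys) = zeros ys
  sum-indegree (x ∷ xs) ys = trans (sum-indegree-∷ x xs ys) (cong (outdegree ys x +_) (sum-indegree xs ys))

  ∃-small-indegree : ∀ D x xs → All (λ v → outdegree (x ∷ xs) v ≤ D) (x ∷ xs) →
                     ∃ λ v → v ∈ x ∷ xs × indegree (x ∷ xs) v ≤ D
  ∃-small-indegree D x xs out with any? (λ v → indegree (x ∷ xs) v ≤? D) (x ∷ xs)
  ... | yes small = find small
  ... | no ¬small = contradiction
    (begin-strict
      length (x ∷ xs) * D                        <⟨ *-monoʳ-< (length (x ∷ xs)) (n<1+n D) ⟩
      length (x ∷ xs) * suc D                    ≤⟨ sum-map-≥ _ _ (All.map ≰⇒> (All.¬Any⇒All¬ _ ¬small)) ⟩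
      sum (map (indegree (x ∷ xs)) (x ∷ xs))     ≡⟨ sum-indegree (x ∷ xs) (x ∷ xs) ⟩
      sum (map (outdegree (x ∷ xs)) (x ∷ xs))    ≤⟨ sum-map-≤ _ _ out ⟩
      length (x ∷ xs) * D                        ∎)
    (<-irrefl refl)
    where open ≤-Reasoning

  Independent : List A → Set
  Independent V = ∀ {i j} → i ∈ V → j ∈ V → i ≢ j → ¬ (i ⟶ j)

  module _ (_≟A_ : DecidableEquality A) (D : ℕ) where

    independentSet′ : ∀ fuel L → length L ≤ fuel → Unique L → (∀ {v} → v ∈ L → outdegree L v ≤ D) →
      ∃ λ V → Unique V × (∀ {v} → v ∈ V → v ∈ L) × Independent V × length L ≤ suc (D + D) * length V
    independentSet′ _ [] _ _ _ = [] , [] , (λ ()) , (λ ()) , z≤n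
    independentSet′ (suc fuel) L@(x ∷ xs) L≤ u out
      with v , v∈ , in≤ ← ∃-small-indegree D x xs (All.tabulate out)
      = extend (independentSet′ fuel L′ (s≤s⁻¹ (≤-trans (filter-notAll far? L (lose v∈ λ far → proj₁ far refl)) L≤))
                 (filter⁺ far? u)
                 λ w∈ → ≤-trans (count-mono (_ ⟶?_) (_ ⟶?_) (filter⁺ far? u) ∈L (λ _ p → p)) (out (∈L w∈)))
      where
        Far : Pred A 0ℓ
        Far w = w ≢ v × ¬ (v ⟶ w) × ¬ (w ⟶ v)
        far? : Decidable₁ Far
        far? w = ¬? (w ≟A v) ×-dec ¬? (v ⟶? w) ×-dec ¬? (w ⟶? v)
        L′ : List A
        L′ = filter far? L
        ∈L : ∀ {w} → w ∈ L′ → w ∈ L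
        ∈L w∈ = proj₁ (∈-filter⁻ far? {xs = L} w∈)
        far : ∀ {w} → w ∈ L′ → Far w
        far w∈ = proj₂ (∈-filter⁻ far? {xs = L} w∈)
        cover : ∀ {w} → w ∈ L → w ∈ v ∷ filter (v ⟶?_) L ++ filter (_⟶? v) L ++ L′
        cover {w} w∈ with w ≟A v | v ⟶? w | w ⟶? v
        ... | yes refl | _ | _ = here refl
        ... | no _ | yes p | _ = there (∈-++⁺ˡ (∈-filter⁺ (v ⟶?_) w∈ p))
        ... | no _ | no _ | yes p = there (∈-++⁺ʳ (filter (v ⟶?_) L) (∈-++⁺ˡ (∈-filter⁺ (_⟶? v) w∈ p)))
        ... | no p | no q | no r = there (∈-++⁺ʳ (filter (v ⟶?_) L) (∈-++⁺ʳ (filter (_⟶? v) L)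
                                     (∈-filter⁺ far? w∈ (p , q , r))))
        extend : (∃ λ V → Unique V × (∀ {w} → w ∈ V → w ∈ L′) × Independent V × length L′ ≤ suc (D + D) * length V) →
                 ∃ λ V → Unique V × (∀ {w} → w ∈ V → w ∈ L) × Independent V × length L ≤ suc (D + D) * length V
        extend (V , uV , sub , ind , bound) =
          v ∷ V , (All.tabulate (λ w∈ v≡w → proj₁ (far (sub w∈)) (sym v≡w)) ∷ uV) , sub′ , ind′ , bound′
          where
            open ≤-Reasoning
            sub′ : ∀ {w} → w ∈ v ∷ V → w ∈ L
            sub′ (here refl) = v∈
            sub′ (there w∈) = ∈L (sub w∈)
            ind′ : Independent (v ∷ V)
            ind′ (here refl) (here refl) i≢j = contradiction refl i≢j
            ind′ (here refl) (there j∈) _ = proj₁ (proj₂ (far (sub j∈)))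
            ind′ (there i∈) (here refl) _ = proj₂ (proj₂ (far (sub i∈)))
            ind′ (there i∈) (there j∈) = ind i∈ j∈
            bound′ : length L ≤ suc (D + D) * length (v ∷ V)
            bound′ = begin
              length L                                                       ≤⟨ length-⊆ u cover ⟩
              suc (length (filter (v ⟶?_) L ++ filter (_⟶? v) L ++ L′))      ≡⟨ cong suc (length-++ (filter (v ⟶?_) L)) ⟩
              suc (outdegree L v + length (filter (_⟶? v) L ++ L′))          ≡⟨ cong (λ z → suc (outdegree L v + z)) (length-++ (filter (_⟶? v) L)) ⟩
              suc (outdegree L v + (indegree L v + length L′))               ≤⟨ s≤s (+-mono-≤ (out v∈) (+-mono-≤ in≤ bound)) ⟩
              suc (D + (D + suc (D + D) * length V))                         ≡⟨ cong suc (sym (+-assoc D D _)) ⟩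
              suc (D + D) + suc (D + D) * length V                           ≡⟨ sym (*-suc (suc (D + D)) (length V)) ⟩
              suc (D + D) * suc (length V)                                   ∎

    independentSet : ∀ L → Unique L → (∀ {v} → v ∈ L → outdegree L v ≤ D) →
      ∃ λ V → Unique V × (∀ {v} → v ∈ V → v ∈ L) × Independent V × length L ≤ suc (D + D) * length V
    independentSet L = independentSet′ (length L) L ≤-refl

module Difference {A : Set} (_≟A_ : DecidableEquality A) where

  open DecMembership _≟A_ using (_∈?_)

  infixl 6 _∖_
  _∖_ : List A → List A → List A
  S ∖ V = filter (λ x → ¬? (x ∈? V)) S

  length-∖ : ∀ {S V} → Unique V → (∀ {v} → v ∈ V → v ∈ S) → length V + length (S ∖ V) ≤ length S
  length-∖ {S} {V} uV V⊆S = begin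
    length V + length (S ∖ V)          ≤⟨ +-monoˡ-≤ _ (length-⊆ uV λ v∈ → ∈-filter⁺ (_∈? V) (V⊆S v∈) v∈) ⟩
    count (_∈? V) S + length (S ∖ V)   ≡⟨ count+count-¬ (_∈? V) S ⟩
    length S                           ∎
    where open ≤-Reasoning

module Rounds {A E : Set} (_≟A_ : DecidableEquality A) {_∋_ : E → Pred A 0ℓ}
              (_∋?_ : ∀ e → Decidable₁ (e ∋_)) (K : ℕ) where

  open DecMembership _≟A_ using (_∈?_)
  open Difference _≟A_

  AtMostOneIn : List A → E → Set
  AtMostOneIn V e = ∀ {i j} → i ∈ V → j ∈ V → e ∋ i → e ∋ j → i ≡ j

  Removable : List A → List A → Set
  Removable S V = ∀ e → AtMostOneIn V e ⊎ K ≤ count (e ∋?_) (S ∖ V)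

  UniqueIn : (A → ℕ) → List A → E → Pred A 0ℓ
  UniqueIn c S e i = i ∈ S × e ∋ i × (∀ {j} → j ∈ S → e ∋ j → c j ≡ c i → j ≡ i)

  ManyUnique Rainbow : (A → ℕ) → List A → E → Set
  ManyUnique c S e = ∃ λ U → length U ≡ K × Unique U × All (UniqueIn c S e) U
  Rainbow c S e = ∀ {i j} → i ∈ S → j ∈ S → e ∋ i → e ∋ j → c i ≡ c j → i ≡ j

  Colourable : ℕ → List A → Set
  Colourable t S = ∃ λ c → (∀ i → c i ≤ t) × (∀ e → ManyUnique c S e ⊎ Rainbow c S e)

  colourable-mono : ∀ {s t S} → s ≤ t → Colourable s S → Colourable t S
  colourable-mono s≤t (c , bound , good) = c , (λ i → ≤-trans (bound i) s≤t) , good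

  colourable-[] : Colourable 0 []
  colourable-[] = (λ _ → 0) , (λ _ → z≤n) , λ _ → inj₂ λ ()

  colourable-suc : ∀ {t S V} → Unique S → Removable S V → Colourable t (S ∖ V) → Colourable (suc t) S
  colourable-suc {t} {S} {V} uS rem (c , bound , good) = (λ i → c′ (i ∈? V)) , (λ i → bound′ (i ∈? V)) , good′
    where
      c′ : ∀ {i} → Dec (i ∈ V) → ℕ
      c′ (yes _) = 0
      c′ {i} (no _) = suc (c i)
      bound′ : ∀ {i} (d : Dec (i ∈ V)) → c′ d ≤ suc t
      bound′ (yes _) = z≤n
      bound′ {i} (no _) = s≤s (bound i)
      ∈∖ : ∀ {i} → i ∈ S → i ∉ V → i ∈ S ∖ V
      ∈∖ = ∈-filter⁺ (λ x → ¬? (x ∈? V))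
      ∖∈ : ∀ {i} → i ∈ S ∖ V → i ∈ S × i ∉ V
      ∖∈ = ∈-filter⁻ (λ x → ¬? (x ∈? V))
      lift : ∀ {e i} → UniqueIn c (S ∖ V) e i → UniqueIn (λ i → c′ (i ∈? V)) S e i
      lift {e} {i} (i∈ , e∋i , uniq) = proj₁ (∖∈ i∈) , e∋i , λ {j} j∈ e∋j → uniq′ j∈ e∋j (j ∈? V) (i ∈? V)
        where
          uniq′ : ∀ {j} → j ∈ S → e ∋ j → (d : Dec (j ∈ V)) (d′ : Dec (i ∈ V)) → c′ d ≡ c′ d′ → j ≡ i
          uniq′ j∈ e∋j _ (yes i∈V) _ = contradiction i∈V (proj₂ (∖∈ i∈))
          uniq′ j∈ e∋j (no j∉V) (no _) eq = uniq (∈∖ j∈ j∉V) e∋j (suc-injective eq)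
      good′ : ∀ e → ManyUnique (λ i → c′ (i ∈? V)) S e ⊎ Rainbow (λ i → c′ (i ∈? V)) S e
      good′ e with good e | rem e
      ... | inj₁ (U , |U| , uU , all) | _ = inj₁ (U , |U| , uU , All.map lift all)
      ... | inj₂ rainbow | inj₁ atMostOne = inj₂ λ {i} {j} i∈ j∈ e∋i e∋j → rainbow′ i∈ j∈ e∋i e∋j (i ∈? V) (j ∈? V)
        where
          rainbow′ : ∀ {i j} → i ∈ S → j ∈ S → e ∋ i → e ∋ j →
                     (d : Dec (i ∈ V)) (d′ : Dec (j ∈ V)) → c′ d ≡ c′ d′ → i ≡ j
          rainbow′ _ _ e∋i e∋j (yes i∈V) (yes j∈V) _ = atMostOne i∈V j∈V e∋i e∋j
          rainbow′ i∈ j∈ e∋i e∋j (no i∉V) (no j∉V) eq = rainbow (∈∖ i∈ i∉V) (∈∖ j∈ j∉V) e∋i e∋j (suc-injective eq)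
      ... | inj₂ rainbow | inj₂ many = inj₁
        ( take K F , trans (length-take K F) (m≤n⇒m⊓n≡m many) , take⁺ K (filter⁺ (e ∋?_) (filter⁺ (λ x → ¬? (x ∈? V)) uS))
        , All.take⁺ K (All.tabulate λ i∈ → let i∈S∖V , e∋i = ∈-filter⁻ (e ∋?_) {xs = S ∖ V} i∈ in
            lift (i∈S∖V , e∋i , λ j∈ e∋j → rainbow j∈ i∈S∖V e∋j e∋i)) )
        where
          F : List A
          F = filter (e ∋?_) (S ∖ V)

  module _ (Base : Pred A 0ℓ) (M : ℕ) .{{_ : NonZero M}}
           (step : ∀ {S} → Unique S → All Base S →
                   ∃ λ V → Unique V × (∀ {v} → v ∈ V → v ∈ S) × Removable S V × length S ≤ M * length V) where

    -- M rounds suffice to halve the number of remaining vertices.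
    colourable-halving : ∀ j → (∀ {S} → Unique S → All Base S → length S < 2 ^ j → Colourable (M * j) S) →
      ∀ a {S} → Unique S → All Base S → M * length S < M * 2 ^ j + a * 2 ^ j → Colourable (M * j + a) S
    colourable-halving j small zero {S} uS base lt =
      colourable-mono (≤-reflexive (sym (+-identityʳ _)))
        (small uS base (*-cancelˡ-< M _ _ (subst (M * length S <_) (+-identityʳ _) lt)))
    colourable-halving j small (suc a) {S} uS base lt with length S <? 2 ^ j
    ... | yes S<2^j = colourable-mono (m≤m+n _ _) (small uS base S<2^j)
    ... | no  S≮2^j with V , uV , V⊆S , rem , S≤ ← step uS base =
      colourable-mono (≤-reflexive (sym (+-suc (M * j) a)))
        (colourable-suc uS rem (colourable-halving j small a (filter⁺ _ uS) (All.filter⁺ _ base) lt′))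
      where
        open ≤-Reasoning
        lt′ : M * length (S ∖ V) < M * 2 ^ j + a * 2 ^ j
        lt′ = +-cancelˡ-< (2 ^ j) _ _ (begin-strict
          2 ^ j + M * length (S ∖ V)              ≤⟨ +-monoˡ-≤ _ (≤-trans (≮⇒≥ S≮2^j) S≤) ⟩
          M * length V + M * length (S ∖ V)       ≡⟨ sym (*-distribˡ-+ M (length V) _) ⟩
          M * (length V + length (S ∖ V))         ≤⟨ *-monoʳ-≤ M (length-∖ uV V⊆S) ⟩
          M * length S                            <⟨ lt ⟩
          M * 2 ^ j + (2 ^ j + a * 2 ^ j)         ≡⟨ x∙yz≈y∙xz +-commutativeSemigroup (M * 2 ^ j) (2 ^ j) _ ⟩
          2 ^ j + (M * 2 ^ j + a * 2 ^ j)         ∎)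

    colourable : ∀ j {S} → Unique S → All Base S → length S < 2 ^ j → Colourable (M * j) S
    colourable zero {[]} _ _ _ = colourable-mono z≤n colourable-[]
    colourable zero {_ ∷ _} _ _ (s≤s ())
    colourable (suc j) {S} uS base lt =
      colourable-mono (≤-reflexive (trans (+-comm (M * j) M) (sym (*-suc M j))))
        (colourable-halving j (colourable j) M uS base (begin-strict
          M * length S                <⟨ *-monoʳ-< M lt ⟩
          M * (2 ^ j + (2 ^ j + 0))   ≡⟨ cong (λ z → M * (2 ^ j + z)) (+-identityʳ _) ⟩
          M * (2 ^ j + 2 ^ j)         ≡⟨ *-distribˡ-+ M (2 ^ j) (2 ^ j) ⟩
          M * 2 ^ j + M * 2 ^ j       ∎))
      where open ≤-Reasoning

⌊m/2⌋<n : ∀ {m n} → m < n + n → ⌊ m /2⌋ < n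
⌊m/2⌋<n {m} {n} m<2n = ≰⇒> λ n≤ → <⇒≱ m<2n (begin
  n + n                   ≤⟨ +-mono-≤ n≤ (≤-trans n≤ (⌊n/2⌋≤⌈n/2⌉ m)) ⟩
  ⌊ m /2⌋ + ⌈ m /2⌉       ≡⟨ ⌊n/2⌋+⌈n/2⌉≡n m ⟩
  m                       ∎)
  where open ≤-Reasoning

m≤1+2⌊m/2⌋ : ∀ m → m ≤ suc (⌊ m /2⌋ + ⌊ m /2⌋)
m≤1+2⌊m/2⌋ zero = z≤n
m≤1+2⌊m/2⌋ (suc zero) = ≤-refl
m≤1+2⌊m/2⌋ (suc (suc m)) = s≤s (subst (suc m ≤_) (cong suc (sym (+-suc ⌊ m /2⌋ _))) (s≤s (m≤1+2⌊m/2⌋ m)))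

2⌊m/2⌋≤m : ∀ m → ⌊ m /2⌋ + ⌊ m /2⌋ ≤ m
2⌊m/2⌋≤m m = ≤-trans (+-monoʳ-≤ ⌊ m /2⌋ (⌊n/2⌋≤⌈n/2⌉ m)) (≤-reflexive (⌊n/2⌋+⌈n/2⌉≡n m))

n<2^[1+⌊log₂n⌋] : ∀ n → n < 2 ^ suc ⌊log₂ n ⌋
n<2^[1+⌊log₂n⌋] = <-rec _ bound
  where
    bound : ∀ n → (∀ {m} → m < n → m < 2 ^ suc ⌊log₂ m ⌋) → n < 2 ^ suc ⌊log₂ n ⌋
    bound zero _ = s≤s z≤n
    bound (suc zero) _ = s≤s (s≤s z≤n)
    bound n@(suc (suc m)) rec = begin
      suc n                                     ≤⟨ s≤s (m≤1+2⌊m/2⌋ n) ⟩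
      suc (suc (⌊ n /2⌋ + ⌊ n /2⌋))             ≡⟨ cong suc (sym (+-suc ⌊ n /2⌋ ⌊ n /2⌋)) ⟩
      suc ⌊ n /2⌋ + suc ⌊ n /2⌋                 ≤⟨ +-mono-≤ half half ⟩
      2 ^ ⌊log₂ n ⌋ + 2 ^ ⌊log₂ n ⌋             ≡⟨ cong (2 ^ ⌊log₂ n ⌋ +_) (sym (+-identityʳ _)) ⟩
      2 ^ suc ⌊log₂ n ⌋                         ∎
      where
        open ≤-Reasoning
        1+log : suc ⌊log₂ ⌊ n /2⌋ ⌋ ≡ ⌊log₂ n ⌋
        1+log = trans (cong suc (⌊log₂⌊n/2⌋⌋≡⌊log₂n⌋∸1 n)) (m+[n∸m]≡n (⌊log₂⌋-mono-≤ {2} {n} (s≤s (s≤s z≤n))))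
        half : ⌊ n /2⌋ < 2 ^ ⌊log₂ n ⌋
        half = subst (λ ℓ → ⌊ n /2⌋ < 2 ^ ℓ) 1+log (rec (⌊n/2⌋<n (suc m)))

halves : ℕ → ℕ → ℕ
halves zero    a = a
halves (suc ℓ) a = ⌊ halves ℓ a /2⌋

halves-mono : ∀ ℓ {a b} → a ≤ b → halves ℓ a ≤ halves ℓ b
halves-mono zero    a≤b = a≤b
halves-mono (suc ℓ) a≤b = ⌊n/2⌋-mono (halves-mono ℓ a≤b)

halves-suc : ∀ ℓ a → halves (suc ℓ) a ≡ halves ℓ ⌊ a /2⌋
halves-suc zero    a = refl
halves-suc (suc ℓ) a = cong ⌊_/2⌋ (halves-suc ℓ a)

halves≡0 : ∀ ℓ {a} → a < 2 ^ ℓ → halves ℓ a ≡ 0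
halves≡0 zero {zero} _ = refl
halves≡0 zero {suc _} (s≤s ())
halves≡0 (suc ℓ) {a} a<2^ =
  trans (halves-suc ℓ a) (halves≡0 ℓ (⌊m/2⌋<n (subst (a <_) (cong (2 ^ ℓ +_) (+-identityʳ _)) a<2^)))

parity : ∀ m → m ≡ ⌊ m /2⌋ + ⌊ m /2⌋ ⊎ m ≡ suc (⌊ m /2⌋ + ⌊ m /2⌋)
parity m with m≤n⇒m<n∨m≡n (m≤1+2⌊m/2⌋ m)
... | inj₁ m< = inj₁ (≤-antisym (s≤s⁻¹ m<) (2⌊m/2⌋≤m m))
... | inj₂ m≡ = inj₂ m≡

separates : ∀ {x y} r → x ≤ y → x ≢ y → ⌊ x /2⌋ ≡ ⌊ r /2⌋ → ⌊ y /2⌋ ≡ ⌊ r /2⌋ → 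
            (r ≡ ⌊ r /2⌋ + ⌊ r /2⌋ → r < y) × (r ≡ suc (⌊ r /2⌋ + ⌊ r /2⌋) → x < r)
separates {x} {y} r x≤y x≢y ex ey =
    (λ even → <-≤-trans (s≤s (subst (_≤ x) (trans (cong (λ h → h + h) ex) (sym even)) (2⌊m/2⌋≤m x))) x<y)
  , (λ odd → <-≤-trans x<y (subst (y ≤_) (trans (cong (λ h → suc (h + h)) ey) (sym odd)) (m≤1+2⌊m/2⌋ y)))
  where
    x<y : x < y
    x<y = ≤∧≢⇒< x≤y x≢y

firstHolding : {P : Pred ℕ 0ℓ} → Decidable₁ P → ∀ N → P N →
               ∃ λ ℓ → ℓ ≤ N × P ℓ × (∀ {j} → ℓ ≡ suc j → ¬ P j)
firstHolding P? zero PN = 0 , z≤n , PN , λ ()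
firstHolding P? (suc N) P1+N with P? N
... | no ¬PN = suc N , ≤-refl , P1+N , λ { refl → ¬PN }
... | yes PN = let ℓ , ℓ≤N , rest = firstHolding P? N PN in ℓ , m≤n⇒m≤1+n ℓ≤N , rest

-- block x ℓ is the only group of level ℓ that can have members containing x.
record Levelling {n : ℕ} (N : ℕ) (left right : Fin n → ℚ) : Set where
  field
    level group : Fin n → ℕ
    block : ℚ → ℕ → ℕ

  InBlock : ℚ → ℕ → Pred (Fin n) 0ℓ
  InBlock x ℓ i = left i ℚ.≤ right i × level i ≡ ℓ × group i ≡ block x ℓ

  field
    level≤N : ∀ i → level i ≤ N
    group-stabbed : ∀ {i x} → left i ℚ.≤ x → x ℚ.≤ right i → group i ≡ block x (level i)
    one-sided : ∀ x ℓ → (∀ i → InBlock x ℓ i → left i ℚ.≤ x) ⊎ (∀ i → InBlock x ℓ i → x ℚ.≤ right i)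

module Levels {n : ℕ} (N : ℕ) (n<2^N : n < 2 ^ N) (left right : Fin n → ℚ) where

  rank : ℚ → ℕ
  rank q = count (λ i → left i ℚ.≤? q) (allFin n)

  rank≤n : ∀ q → rank q ≤ n
  rank≤n q = ≤-trans (length-filter (λ i → left i ℚ.≤? q) (allFin n)) (≤-reflexive (length-tabulate _))

  rank-mono : ∀ {p q} → p ℚ.≤ q → rank p ≤ rank q
  rank-mono {p} {q} p≤q = count-mono (λ i → left i ℚ.≤? p) (λ i → left i ℚ.≤? q)
    (allFin⁺ n) (λ i∈ → i∈) (λ _ l≤p → ℚ.≤-trans l≤p p≤q)

  rank-reflects-< : ∀ {p q} → rank p < rank q → p ℚ.≤ q
  rank-reflects-< {p} {q} lt with p ℚ.≤? q
  ... | yes p≤q = p≤q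
  ... | no  p≰q = contradiction (rank-mono (ℚ.<⇒≤ (ℚ.≰⇒> p≰q))) (<⇒≱ lt)

  rank-left-reflects : ∀ i {q} → rank (left i) ≤ rank q → left i ℚ.≤ q
  rank-left-reflects i {q} le with left i ℚ.≤? q
  ... | yes l≤q = l≤q
  ... | no  l≰q = contradiction le (<⇒≱ (length-⊆ unique sub))
    where
      ≤q? : Decidable₁ (λ j → left j ℚ.≤ q)
      ≤q? j = left j ℚ.≤? q
      unique : Unique (i ∷ filter ≤q? (allFin n))
      unique = All.tabulate (λ { j∈ refl → l≰q (proj₂ (∈-filter⁻ ≤q? {xs = allFin n} j∈)) })
             ∷ filter⁺ ≤q? (allFin⁺ n)
      sub : ∀ {j} → j ∈ i ∷ filter ≤q? (allFin n) → j ∈ filter (λ j → left j ℚ.≤? left i) (allFin n)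
      sub (here refl) = ∈-filter⁺ (λ j → left j ℚ.≤? left i) (∈-allFin i) ℚ.≤-refl
      sub (there j∈) = ∈-filter⁺ (λ j → left j ℚ.≤? left i) (∈-allFin _)
        (ℚ.≤-trans (proj₂ (∈-filter⁻ ≤q? {xs = allFin n} j∈)) (ℚ.<⇒≤ (ℚ.≰⇒> l≰q)))

  SameBlock : Fin n → ℕ → Set
  SameBlock i ℓ = halves ℓ (rank (left i)) ≡ halves ℓ (rank (right i))

  firstLevel : ∀ i → ∃ λ ℓ → ℓ ≤ N × SameBlock i ℓ × (∀ {j} → ℓ ≡ suc j → ¬ SameBlock i j)
  firstLevel i = firstHolding (λ ℓ → halves ℓ (rank (left i)) ≟ halves ℓ (rank (right i))) N
    (trans (halves≡0 N (≤-<-trans (rank≤n (left i)) n<2^N)) (sym (halves≡0 N (≤-<-trans (rank≤n (right i)) n<2^N))))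

  level group : Fin n → ℕ
  level i = proj₁ (firstLevel i)
  group i = halves (level i) (rank (left i))

  level≤N : ∀ i → level i ≤ N
  level≤N i = proj₁ (proj₂ (firstLevel i))

  group-right : ∀ i → group i ≡ halves (level i) (rank (right i))
  group-right i = proj₁ (proj₂ (proj₂ (firstLevel i)))

  group-stabbed : ∀ {i x} → left i ℚ.≤ x → x ℚ.≤ right i → group i ≡ halves (level i) (rank x)
  group-stabbed {i} l≤x x≤r = ≤-antisym (halves-mono (level i) (rank-mono l≤x))
    (≤-trans (halves-mono (level i) (rank-mono x≤r)) (≤-reflexive (sym (group-right i))))

  InGroup : ℕ → ℕ → Pred (Fin n) 0ℓ
  InGroup ℓ g i = left i ℚ.≤ right i × level i ≡ ℓ × group i ≡ g

  halves-reflects-< : ∀ j {a b} → halves j a < halves j b → a < b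
  halves-reflects-< j lt = ≰⇒> λ b≤a → <⇒≱ lt (halves-mono j b≤a)

  -- The intervals of one group share a point; x lies to its right or to its left.
  one-sided : ∀ x ℓ → (∀ i → InGroup ℓ (halves ℓ (rank x)) i → left i ℚ.≤ x)
                    ⊎ (∀ i → InGroup ℓ (halves ℓ (rank x)) i → x ℚ.≤ right i)
  one-sided x zero = inj₁ λ i (_ , lev , grp) →
    rank-left-reflects i (≤-reflexive (subst (λ ℓ → halves ℓ (rank (left i)) ≡ rank x) lev grp))
  one-sided x (suc j) = [ (λ even → inj₂ λ i g → rank-reflects-< (halves-reflects-< j (proj₁ (sep g) even)))
                        , (λ odd  → inj₁ λ i g → rank-reflects-< (halves-reflects-< j (proj₂ (sep g) odd))) ]′
                        (parity (halves j (rank x)))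
    where
      r : ℕ
      r = halves j (rank x)
      sep : ∀ {i} → InGroup (suc j) ⌊ r /2⌋ i →
            (r ≡ ⌊ r /2⌋ + ⌊ r /2⌋ → r < halves j (rank (right i))) ×
            (r ≡ suc (⌊ r /2⌋ + ⌊ r /2⌋) → halves j (rank (left i)) < r)
      sep {i} (l≤r , lev , grp) = separates r (halves-mono j (rank-mono l≤r))
        (proj₂ (proj₂ (proj₂ (firstLevel i))) lev)
        (subst (λ ℓ → halves ℓ (rank (left i)) ≡ ⌊ r /2⌋) lev grp)
        (subst (λ ℓ → halves ℓ (rank (right i)) ≡ ⌊ r /2⌋) lev (trans (sym (group-right i)) grp))

  levelling : Levelling N left right
  levelling = record
    { level = level ; group = group ; block = λ x ℓ → halves ℓ (rank x)
    ; level≤N = level≤N ; group-stabbed = λ {i} {x} → group-stabbed {i} {x} ; one-sided = one-sided }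

module _ {n : ℕ} where

  private
    module Lex = DecTotalOrder (×-decTotalOrder ℚ.≤-decTotalOrder (Fin.≤-decTotalOrder n))

  -- Ties in the key are broken by index, so that ≼[ κ ] is antisymmetric.
  _≼[_]_ : Fin n → (Fin n → ℚ) → Fin n → Set
  i ≼[ κ ] j = (κ i , i) Lex.≤ (κ j , j)

  ≼-dec : ∀ κ → Decidable (λ i j → i ≼[ κ ] j)
  ≼-dec κ i j = (κ i , i) Lex.≤? (κ j , j)

  ≼-total : ∀ κ → Total (λ i j → i ≼[ κ ] j)
  ≼-total κ i j = Lex.total (κ i , i) (κ j , j)

  ≼-trans : ∀ κ → Transitive (λ i j → i ≼[ κ ] j)
  ≼-trans κ {i} {j} {l} = Lex.trans {κ i , i} {κ j , j} {κ l , l}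

  ≼-antisym : ∀ κ {i j} → i ≼[ κ ] j → j ≼[ κ ] i → i ≡ j
  ≼-antisym κ {i} {j} p q = proj₂ (Lex.antisym {κ i , i} {κ j , j} p q)

  ≼⇒≤ : ∀ κ {i j} → i ≼[ κ ] j → κ i ℚ.≤ κ j
  ≼⇒≤ κ (inj₁ (≤ , _)) = ≤
  ≼⇒≤ κ (inj₂ (≡ , _)) = ℚ.≤-reflexive ≡

module Charging {n : ℕ} (group : Fin n → ℕ) (k : ℕ) (L : List (Fin n)) (uL : Unique L) where

  Key : Set
  Key = Fin n → ℚ

  Above : Key → Key → Fin n → Pred (Fin n) 0ℓ
  Above α β w v = group v ≡ group w × w ≼[ α ] v × w ≼[ β ] v

  above? : ∀ α β w → Decidable₁ (Above α β w)
  above? α β w v = (group v ≟ group w) ×-dec ≼-dec α w v ×-dec ≼-dec β w v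

  Charged : Key → Key → Key → Rel (Fin n) 0ℓ
  Charged α β γ w = TopRanked (≼-dec γ) (≼-total γ) (≼-trans γ) (above? α β w) k L

  charged? : ∀ α β γ → Decidable (Charged α β γ)
  charged? α β γ w = topRanked? (≼-dec γ) (≼-total γ) (≼-trans γ) (above? α β w) k L

  count-charged : ∀ α β γ w → count (charged? α β γ w) L ≤ k
  count-charged α β γ w = count-topRanked (≼-dec γ) (≼-total γ) (≼-trans γ) (above? α β w) k uL

  Arc : Key → Key → Key → Rel (Fin n) 0ℓ
  Arc α β γ w z = Charged α β γ w z ⊎ Charged α γ β w z ⊎ Charged β γ α w z

  arc? : ∀ α β γ → Decidable (Arc α β γ)
  arc? α β γ w z = charged? α β γ w z ⊎-dec charged? α γ β w z ⊎-dec charged? β γ α w z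

  count-arc : ∀ α β γ w → count (arc? α β γ w) L ≤ k + (k + k)
  count-arc α β γ w = ≤-trans (count-⊎ (charged? α β γ w) (λ z → charged? α γ β w z ⊎-dec charged? β γ α w z) uL)
    (+-mono-≤ (count-charged α β γ w) (≤-trans (count-⊎ (charged? α γ β w) (charged? β γ α w) uL)
      (+-mono-≤ (count-charged α γ β w) (count-charged β γ α w))))

  AboveOne : Key → Fin n → Fin n → Pred (Fin n) 0ℓ
  AboveOne κ i j v = i ≼[ κ ] v ⊎ j ≼[ κ ] v

  Hull : Key → Key → Key → Fin n → Fin n → Pred (Fin n) 0ℓ
  Hull α β γ i j v = group v ≡ group i × AboveOne α i j v × AboveOne β i j v × AboveOne γ i j v

  hull? : ∀ α β γ i j → Decidable₁ (Hull α β γ i j)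
  hull? α β γ i j v = (group v ≟ group i) ×-dec one? α ×-dec one? β ×-dec one? γ
    where
      one? : ∀ κ → Dec (AboveOne κ i j v)
      one? κ = ≼-dec κ i v ⊎-dec ≼-dec κ j v

  charge : ∀ {H : Pred (Fin n) 0ℓ} (H? : Decidable₁ H) α β γ {i j} → group j ≡ group i →
           i ≼[ α ] j → i ≼[ β ] j → count H? L ≤ k →
           (∀ {v} → Above α β i v → j ≼[ γ ] v → H v) → Charged α β γ i j
  charge H? α β γ {i} {j} g p q small sub = (g , p , q) ,
    ≤-trans (count-mono (λ v → above? α β i v ×-dec ≼-dec γ j v) H? uL (λ v∈ → v∈) (λ _ (a , r) → sub a r)) small

  -- By pigeonhole one of i and j is the lower one in two of the three orders; it is charged for the other.
  small-hull⇒arc : ∀ α β γ {i j} → group j ≡ group i → count (hull? α β γ i j) L ≤ k →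
                   Arc α β γ i j ⊎ Arc α β γ j i
  small-hull⇒arc α β γ {i} {j} g small with ≼-total α i j | ≼-total β i j | ≼-total γ i j
  ... | inj₁ a | inj₁ b | _ = inj₁ (inj₁ (charge (hull? α β γ i j) α β γ g a b small
          λ (gv , a , b) c → gv , inj₁ a , inj₁ b , inj₂ c))
  ... | inj₂ a | inj₂ b | _ = inj₂ (inj₁ (charge (hull? α β γ i j) α β γ (sym g) a b small
          λ (gv , a , b) c → trans gv g , inj₂ a , inj₂ b , inj₁ c))
  ... | inj₁ a | inj₂ b | inj₁ c = inj₁ (inj₂ (inj₁ (charge (hull? α β γ i j) α γ β g a c small
          λ (gv , a , c) b → gv , inj₁ a , inj₂ b , inj₁ c)))
  ... | inj₁ a | inj₂ b | inj₂ c = inj₂ (inj₂ (inj₂ (charge (hull? α β γ i j) β γ α (sym g) b c small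
          λ (gv , b , c) a → trans gv g , inj₁ a , inj₂ b , inj₂ c)))
  ... | inj₂ a | inj₁ b | inj₁ c = inj₁ (inj₂ (inj₂ (charge (hull? α β γ i j) β γ α g b c small
          λ (gv , b , c) a → gv , inj₂ a , inj₁ b , inj₁ c)))
  ... | inj₂ a | inj₁ b | inj₂ c = inj₂ (inj₂ (inj₁ (charge (hull? α β γ i j) α γ β (sym g) a c small
          λ (gv , a , c) b → trans gv g , inj₂ a , inj₁ b , inj₂ c)))

  open Difference (Fin._≟_ {n})
  open DecMembership (Fin._≟_ {n}) using (_∈?_)

  -- If two members of V lie in E, the hull of the two highest ones in the order of γ contains no other member of V.
  sparse : ∀ α β γ {V} {E : Pred (Fin n) 0ℓ} (E? : Decidable₁ E) → Unique V → (∀ {i} → i ∈ V → i ∈ L) →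
           Independent (arc? α β γ) V →
           (∀ {i j} → i ∈ L → j ∈ L → E i → E j → group j ≡ group i) →
           (∀ {i j v} → i ∈ L → j ∈ L → v ∈ L → E i → E j → Hull α β γ i j v → E v) →
           (∀ {i j} → i ∈ V → j ∈ V → E i → E j → i ≡ j) ⊎ k ≤ suc (count E? (L ∖ V))
  sparse α β γ {V} {E} E? uV V⊆L ind sameGroup closed = cases (filter E? V) refl
    where
      cases : ∀ F → filter E? V ≡ F → (∀ {i j} → i ∈ V → j ∈ V → E i → E j → i ≡ j) ⊎ k ≤ suc (count E? (L ∖ V))
      cases [] eq = inj₁ λ i∈ _ Ei _ → contradiction (subst (_ ∈_) eq (∈-filter⁺ E? i∈ Ei)) λ ()
      cases (x ∷ []) eq = inj₁ λ i∈ j∈ Ei Ej →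
        trans (only (subst (_ ∈_) eq (∈-filter⁺ E? i∈ Ei))) (sym (only (subst (_ ∈_) eq (∈-filter⁺ E? j∈ Ej))))
        where
          only : ∀ {i} → i ∈ x ∷ [] → i ≡ x
          only (here i≡x) = i≡x
      cases F@(x ∷ y ∷ zs) eq with maximum (≼-total γ) (≼-trans γ) x (y ∷ zs)
      ... | m , m∈F , m-max with filter (λ i → ¬? (i Fin.≟ m)) F in eq′
      ...   | [] = contradiction (trans (only (here refl)) (sym (only (there (here refl)))))
                     (All.head (AllPairs.head (subst Unique eq (filter⁺ E? uV))))
        where
          only : ∀ {i} → i ∈ F → i ≡ m
          only {i} i∈ with i Fin.≟ m
          ... | yes i≡m = i≡m
          ... | no  i≢m = contradiction (subst (_ ∈_) eq′ (∈-filter⁺ (λ i → ¬? (i Fin.≟ m)) i∈ i≢m)) λ ()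
      ...   | z ∷ zs′ with maximum (≼-total γ) (≼-trans γ) z zs′
      ...     | u , u∈F′ , u-max = inj₂ (s≤s⁻¹ (≤-trans large (length-⊆ (filter⁺ (hull? α β γ m u) uL) cover)))
        where
          F⁻ : ∀ {i} → i ∈ F → i ∈ V × E i
          F⁻ i∈ = ∈-filter⁻ E? (subst (_ ∈_) (sym eq) i∈)
          F′⁻ : ∀ {i} → i ∈ z ∷ zs′ → i ∈ F × i ≢ m
          F′⁻ i∈ = ∈-filter⁻ (λ i → ¬? (i Fin.≟ m)) {xs = F} (subst (_ ∈_) (sym eq′) i∈)
          u∈F : u ∈ F
          u∈F = proj₁ (F′⁻ u∈F′)
          m∈V = proj₁ (F⁻ m∈F)
          u∈V = proj₁ (F⁻ u∈F)
          Em = proj₂ (F⁻ m∈F)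
          Eu = proj₂ (F⁻ u∈F)
          u≢m : u ≢ m
          u≢m = proj₂ (F′⁻ u∈F′)
          large : k < count (hull? α β γ m u) L
          large = ≰⇒> λ small → [ ind m∈V u∈V (u≢m ∘ sym) , ind u∈V m∈V u≢m ]′
            (small-hull⇒arc α β γ (sameGroup (V⊆L m∈V) (V⊆L u∈V) Em Eu) small)
          u≼ : ∀ {v} → AboveOne γ m u v → u ≼[ γ ] v
          u≼ {v} (inj₁ m≼v) = ≼-trans γ {u} {m} {v} (m-max u∈F) m≼v
          u≼ (inj₂ u≼v) = u≼v
          cover : ∀ {v} → v ∈ filter (hull? α β γ m u) L → v ∈ m ∷ u ∷ filter E? (L ∖ V)
          cover {v} v∈ with v∈L , hull ← ∈-filter⁻ (hull? α β γ m u) {xs = L} v∈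
            with Ev ← closed (V⊆L m∈V) (V⊆L u∈V) v∈L Em Eu hull | v Fin.≟ m | v ∈? V
          ... | yes refl | _ = here refl
          ... | no v≢m | yes v∈V = there (here (≼-antisym γ (u-max (subst (v ∈_) eq′
                  (∈-filter⁺ (λ i → ¬? (i Fin.≟ m)) (subst (v ∈_) eq (∈-filter⁺ E? v∈V Ev)) v≢m)))
                  (u≼ (proj₂ (proj₂ (proj₂ hull))))))
          ... | no _ | no v∉V = there (there (∈-filter⁺ E? (∈-filter⁺ (λ x → ¬? (x ∈? V)) v∈L v∉V) Ev))

neg-cancel-≤ : ∀ {p q} → ℚ.- p ℚ.≤ ℚ.- q → q ℚ.≤ p
neg-cancel-≤ {p} {q} -p≤-q with q ℚ.≤? p
... | yes q≤p = q≤p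
... | no  q≰p = contradiction (ℚ.<-≤-trans (ℚ.neg-antimono-< (ℚ.≰⇒> q≰p)) -p≤-q) (ℚ.<-irrefl refl)

module Rectangles {n : ℕ} (R : Fin n → Rect) (K N : ℕ) (n<2^N : n < 2 ^ N)
                  (levelling : Levelling N (Rect.x₁ ∘ R) (Rect.x₂ ∘ R)) where

  x₁ x₂ y₁ y₂ : Fin n → ℚ
  x₁ = Rect.x₁ ∘ R
  x₂ = Rect.x₂ ∘ R
  y₁ = Rect.y₁ ∘ R
  y₂ = Rect.y₂ ∘ R

  open Levelling levelling
  open Difference (Fin._≟_ {n}) using (_∖_)
  open DecMembership (Fin._≟_ {n}) using (_∈?_)
  open Rounds (Fin._≟_ {n}) {_∋_ = λ p i → p ∈R R i} (λ p i → p ∈R? R i) K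

  k D M : ℕ
  k = suc K
  D = (k + (k + k)) + (k + (k + k))
  M = suc N * suc (D + D)

  NonEmpty : Pred (Fin n) 0ℓ
  NonEmpty i = x₁ i ℚ.≤ x₂ i

  module _ {S : List (Fin n)} (uS : Unique S) (nonEmpty : All NonEmpty S) (ℓ : ℕ) where

    L : List (Fin n)
    L = filter (λ i → level i ≟ ℓ) S

    uL : Unique L
    uL = filter⁺ (λ i → level i ≟ ℓ) uS

    L⁻ : ∀ {i} → i ∈ L → i ∈ S × level i ≡ ℓ
    L⁻ = ∈-filter⁻ (λ i → level i ≟ ℓ)

    open Charging group k L uL

    bottom leftward : Fin n → ℚ
    bottom i = ℚ.- y₁ i
    leftward i = ℚ.- x₁ i

    _⟶_ : Rel (Fin n) 0ℓ
    i ⟶ j = Arc bottom y₂ x₂ i j ⊎ Arc bottom y₂ leftward i j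

    _⟶?_ : Decidable _⟶_
    i ⟶? j = arc? bottom y₂ x₂ i j ⊎-dec arc? bottom y₂ leftward i j

    outdegree≤D : ∀ {v} → v ∈ L → outdegree _⟶?_ L v ≤ D
    outdegree≤D {v} _ = ≤-trans (count-⊎ (arc? bottom y₂ x₂ v) (arc? bottom y₂ leftward v) uL)
      (+-mono-≤ (count-arc bottom y₂ x₂ v) (count-arc bottom y₂ leftward v))

    above-≥ : ∀ κ {q} i j v → q ℚ.≤ κ i → q ℚ.≤ κ j → AboveOne κ i j v → q ℚ.≤ κ v
    above-≥ κ i j v q≤i _ (inj₁ i≼v) = ℚ.≤-trans q≤i (≼⇒≤ κ {i} {v} i≼v)
    above-≥ κ i j v _ q≤j (inj₂ j≼v) = ℚ.≤-trans q≤j (≼⇒≤ κ {j} {v} j≼v)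

    above-≤ : ∀ (f : Fin n → ℚ) {q} i j v → f i ℚ.≤ q → f j ℚ.≤ q →
              AboveOne (λ i → ℚ.- f i) i j v → f v ℚ.≤ q
    above-≤ f {q} i j v i≤q j≤q a = neg-cancel-≤ {q} {f v}
      (above-≥ (λ i → ℚ.- f i) i j v (ℚ.neg-antimono-≤ i≤q) (ℚ.neg-antimono-≤ j≤q) a)

    independent⇒removable : ∀ {V} → Unique V → (∀ {v} → v ∈ V → v ∈ L) → Independent _⟶?_ V → Removable S V
    independent⇒removable {V} uV V⊆L ind p@(px , py) = [ inj₁ , (λ le → inj₂ (≤-trans (s≤s⁻¹ le) L∖V≤S∖V)) ]′ (atLevel (one-sided px ℓ))
      where
        L∖V≤S∖V : count (λ i → p ∈R? R i) (L ∖ V) ≤ count (λ i → p ∈R? R i) (S ∖ V)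
        L∖V≤S∖V = count-mono (λ i → p ∈R? R i) (λ i → p ∈R? R i) (filter⁺ _ uL)
          (λ x∈ → let x∈L , x∉V = ∈-filter⁻ (λ x → ¬? (x ∈? V)) {xs = L} x∈ in
             ∈-filter⁺ (λ x → ¬? (x ∈? V)) (proj₁ (L⁻ x∈L)) x∉V)
          (λ _ p∈ → p∈)
        inGroup : ∀ i → i ∈ L → p ∈R R i → group i ≡ block px ℓ
        inGroup i i∈ ((l , r) , _) = trans (group-stabbed {i} l r) (cong (block px) (proj₂ (L⁻ i∈)))
        hull-inGroup : ∀ i v → i ∈ L → v ∈ L → p ∈R R i → group v ≡ group i → InBlock px ℓ v
        hull-inGroup i v i∈ v∈ pi gv = All.lookup nonEmpty (proj₁ (L⁻ v∈)) , proj₂ (L⁻ v∈) , trans gv (inGroup i i∈ pi)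
        sameGroup : ∀ {i j} → i ∈ L → j ∈ L → p ∈R R i → p ∈R R j → group j ≡ group i
        sameGroup {i} {j} i∈ j∈ pi pj = trans (inGroup j j∈ pj) (sym (inGroup i i∈ pi))
        atLevel : (∀ i → InBlock px ℓ i → x₁ i ℚ.≤ px) ⊎ (∀ i → InBlock px ℓ i → px ℚ.≤ x₂ i) →
                  AtMostOneIn V p ⊎ k ≤ suc (count (λ i → p ∈R? R i) (L ∖ V))
        atLevel (inj₁ rightSide) = sparse bottom y₂ x₂ (λ i → p ∈R? R i) uV V⊆L
          (λ i∈ j∈ i≢j arc → ind i∈ j∈ i≢j (inj₁ arc)) sameGroup
          λ { {i} {j} {v} i∈ j∈ v∈ pi@((_ , ir) , ib , it) ((_ , jr) , jb , jt) (gv , b , t , r) →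
              (rightSide v (hull-inGroup i v i∈ v∈ pi gv) , above-≥ x₂ i j v ir jr r) , above-≤ y₁ i j v ib jb b , above-≥ y₂ i j v it jt t }
        atLevel (inj₂ leftSide) = sparse bottom y₂ leftward (λ i → p ∈R? R i) uV V⊆L
          (λ i∈ j∈ i≢j arc → ind i∈ j∈ i≢j (inj₂ arc)) sameGroup
          λ { {i} {j} {v} i∈ j∈ v∈ pi@((il , _) , ib , it) ((jl , _) , jb , jt) (gv , b , t , l) →
              (above-≤ x₁ i j v il jl l , leftSide v (hull-inGroup i v i∈ v∈ pi gv)) , above-≤ y₁ i j v ib jb b , above-≥ y₂ i j v it jt t }

    removableInLevel : ∃ λ V → Unique V × (∀ {v} → v ∈ V → v ∈ S) × Removable S V ×
                               length L ≤ suc (D + D) * length V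
    removableInLevel =
      let V , uV , V⊆L , ind , L≤ = independentSet _⟶?_ Fin._≟_ D L uL outdegree≤D in
      V , uV , (λ v∈ → proj₁ (L⁻ (V⊆L v∈))) , independent⇒removable uV V⊆L ind , L≤

  removableSet : ∀ {S} → Unique S → All NonEmpty S →
                 ∃ λ V → Unique V × (∀ {v} → v ∈ V → v ∈ S) × Removable S V × length S ≤ M * length V
  removableSet {S} uS nonEmpty =
    let ℓ , popular = pigeonhole level (suc N) uS
        V , uV , V⊆S , rem , L≤ = removableInLevel uS nonEmpty ℓ
    in V , uV , V⊆S , rem , (begin
      length S                                ≤⟨ length-⊆ uS (λ i∈ → ∈-filter⁺ (λ i → level i <? suc N) i∈ (s≤s (level≤N _))) ⟩
      count (λ i → level i <? suc N) S        ≤⟨ popular ⟩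
      suc N * count (λ i → level i ≟ ℓ) S     ≤⟨ *-monoʳ-≤ (suc N) L≤ ⟩
      suc N * (suc (D + D) * length V)        ≡⟨ sym (*-assoc (suc N) (suc (D + D)) (length V)) ⟩
      M * length V                            ∎)
    where open ≤-Reasoning

  nonEmpty? : Decidable₁ NonEmpty
  nonEmpty? i = x₁ i ℚ.≤? x₂ i

  colourable-nonEmpty : Colourable (M * N) (filter nonEmpty? (allFin n))
  colourable-nonEmpty = colourable NonEmpty M removableSet N (filter⁺ nonEmpty? (allFin⁺ n)) (All.all-filter nonEmpty? (allFin n))
    (≤-<-trans (length-filter nonEmpty? (allFin n)) (subst (_< 2 ^ N) (sym (length-tabulate _)) n<2^N))

  colourable⇒kSCF : ∀ {t T} → t < T → Colourable t (filter nonEmpty? (allFin n)) →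
                    ∃ λ (c : Fin n → Fin T) → IsKSCFColouring K R c
  colourable⇒kSCF {t} {T} t<T (c , bound , good) = colour , λ p → scf p (good p)
    where
      colour : Fin n → Fin T
      colour i = Fin.fromℕ< (≤-<-trans (bound i) t<T)
      colour≡⇒ : ∀ {i j} → colour i ≡ colour j → c i ≡ c j
      colour≡⇒ eq = trans (sym (Fin.toℕ-fromℕ< _)) (trans (cong Fin.toℕ eq) (Fin.toℕ-fromℕ< _))
      module _ (p : Point) where
        S : List (Fin n)
        S = filter nonEmpty? (allFin n)
        edge⁻ : ∀ {i} → i ∈ edge R p → i ∈ S × p ∈R R i
        edge⁻ i∈ with _ , pi@((l , r) , _) ← ∈-filter⁻ (λ i → p ∈R? R i) {xs = allFin n} i∈ =
          ∈-filter⁺ nonEmpty? (∈-allFin _) (ℚ.≤-trans l r) , pi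
        edge⁺ : ∀ {i} → p ∈R R i → i ∈ edge R p
        edge⁺ pi = ∈-filter⁺ (λ i → p ∈R? R i) (∈-allFin _) pi
        uEdge : Unique (edge R p)
        uEdge = filter⁺ (λ i → p ∈R? R i) (allFin⁺ n)
        scf : ManyUnique c S p ⊎ Rainbow c S p → SCFEdge K colour (edge R p)
        scf (inj₁ (U , |U| , uU , all)) =
            (λ _ → U , |U| , uU , All.map unique all)
          , (λ small → contradiction (subst (_≤ length (edge R p)) |U|
              (length-⊆ uU λ i∈ → edge⁺ (proj₁ (proj₂ (All.lookup all i∈))))) (<⇒≱ small))
          where
            unique : ∀ {i} → UniqueIn c S p i → UniqueColoured colour (edge R p) i
            unique (_ , pi , uniq) = edge⁺ pi , λ j j∈ eq →
              uniq (proj₁ (edge⁻ j∈)) (proj₂ (edge⁻ j∈)) (colour≡⇒ eq)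
        scf (inj₂ rainbow) =
            (λ large → take K (edge R p) , trans (length-take K (edge R p)) (m≤n⇒m⊓n≡m large) , take⁺ K uEdge
                     , All.take⁺ K (All.tabulate λ i∈ → i∈ , λ j j∈ → distinct j _ j∈ i∈))
          , (λ _ → distinct)
          where
            distinct : ∀ i j → i ∈ edge R p → j ∈ edge R p → colour i ≡ colour j → i ≡ j
            distinct i j i∈ j∈ eq = rainbow (proj₁ (edge⁻ i∈)) (proj₁ (edge⁻ j∈)) (proj₂ (edge⁻ i∈)) (proj₂ (edge⁻ j∈)) (colour≡⇒ eq)

  kSCFColouring : ∀ {T} → M * N < T → ∃ λ (c : Fin n → Fin T) → IsKSCFColouring K R c
  kSCFColouring MN<T = colourable⇒kSCF MN<T colourable-nonEmpty

rounds<colours : ∀ K l → 1 ≤ l → let k = suc K ; D = (k + (k + k)) + (k + (k + k)) in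
  suc (suc l) * suc (D + D) * suc l < 79 * k * l ^ 2
rounds<colours K l@(suc m) _ = begin-strict
  suc (suc l) * suc (D + D) * suc l         ≤⟨ *-mono-≤ (*-mono-≤ 2+l≤3l 1+12k≤13k) 1+l≤2l ⟩
  (3 * l) * (13 * k) * (2 * l)              ≡⟨ solve 2 (λ k l → (con 3 :* l) :* (con 13 :* k) :* (con 2 :* l) := con 78 :* k :* (l :* (l :* con 1))) refl k l ⟩
  78 * k * l ^ 2                            <⟨ *-monoˡ-< (l ^ 2) (*-monoˡ-< k (n<1+n 78)) ⟩
  79 * k * l ^ 2                            ∎
  where
    open ≤-Reasoning
    open +-*-Solver
    k D : ℕ
    k = suc K
    D = (k + (k + k)) + (k + (k + k))
    2+l≤3l : suc (suc l) ≤ 3 * l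
    2+l≤3l = +-mono-≤ {1} {l} (s≤s z≤n) (+-mono-≤ {1} {l} (s≤s z≤n) (m≤m+n l 0))
    1+l≤2l : suc l ≤ 2 * l
    1+l≤2l = +-mono-≤ {1} {l} (s≤s z≤n) (m≤m+n l 0)
    1+12k≤13k : suc (D + D) ≤ 13 * k
    1+12k≤13k = ≤-trans (+-monoˡ-≤ (D + D) (s≤s z≤n))
      (≤-reflexive (solve 1 (λ k → let D = (k :+ (k :+ k)) :+ (k :+ (k :+ k)) in k :+ (D :+ D) := con 13 :* k) refl k))

theorem5 : ∃ λ (C : ℕ) → ∀ (k : ℕ) → 2 ≤ k → ∀ (n : ℕ) → 2 ≤ n →
    (R : Fin n → Rect) → Injective _≡_ _≡_ R →
    ∃ λ (c : Fin n → Fin (C * k * (⌊log₂ n ⌋ ^ 2))) → IsKSCFColouring (k ∸ 1) R c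
theorem5 = 79 , λ where
  (suc K) _ n 2≤n R _ →
    let N = suc ⌊log₂ n ⌋
        n<2^N = n<2^[1+⌊log₂n⌋] n
    in Rectangles.kSCFColouring R K N n<2^N (Levels.levelling N n<2^N (Rect.x₁ ∘ R) (Rect.x₂ ∘ R))
         (rounds<colours K ⌊log₂ n ⌋ (⌊log₂⌋-mono-≤ {2} {n} 2≤n))
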